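{- Let $\alpha>0$. Suppose that the weighted multigraph $G'$ differs from the weighted multigraph $G$ in a $(k,t)$ edge only, with $\Delta\varepsilon_{kt}=\varepsilon\ne 0$, and put $\Delta d_{ij}=d'_{ij}-d_{ij}$ and $\Delta q_{ij}=q'_{ij}-q_{ij}$. Then the following equalities hold for all $i,j=1,\ldots,n$: $$\Delta q_{ij}=-\alpha\varepsilon\,\pi_{i(kt)}\pi_{j(kt)}\frac{d'_{kt}}{d_{kt}}=-\alpha\varepsilon\,\pi'_{i(kt)}\pi'_{j(kt)}\frac{d_{kt}}{d'_{kt}},$$ $$2\Delta d_{ij}=-\alpha\varepsilon(\tau_{i(kt)}-\tau_{j(kt)})^2\frac{d'_{kt}}{d_{kt}}=-\alpha\varepsilon(\tau'_{i(kt)}-\tau'_{j(kt)})^2\frac{d_{kt}}{d'_{kt}}$$ $$\phantom{2\Delta d_{ij}}=-\alpha\varepsilon(\pi_{i(kt)}-\pi_{j(kt)})^2\frac{d'_{kt}}{d_{kt}}=-\alpha\varepsilon(\pi'_{i(kt)}-\pi'_{j(kt)})^2\frac{d_{kt}}{d'_{kt}}.$$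
   Context: A weighted multigraph $G$ has finite vertex set $V(G)=\{1,\ldots,n\}$; multiple edges are allowed, loops are not, and all edge weights are strictly positive. Its Laplacian matrix $L=L(G)=(\ell_{ij})$ is given by: for $j\ne i$, $\ell_{ij}$ is minus the sum of the weights of all edges with terminal vertices $i$ and $j$; and $\ell_{ii}=-\sum_{j\neq i}\ell_{ij}$. For a fixed parameter $\alpha>0$, the relative forest accessibility matrix is $Q=(q_{ij})=(I+\alpha L)^{ -1}$, and the forest distance is $d_{ij}=\frac12(q_{ii}+q_{jj}-q_{ij}-q_{ji})$ (this is a metric on $V(G)$). For vertices $i,k,t$, put $\tau_{i(kt)}=d_{ik}-d_{it}$ and $\pi_{i(kt)}=q_{ik}-q_{it}$. For $k\neq t$, a weighted multigraph $G'$ (on the same vertex set) differs from $G$ in a $(k,t)$ edge only, with $\Delta\varepsilon_{kt}=\varepsilon\neq0$, if $G'$ is obtained from $G$ by increasing the weight of some edge between $k$ and $t$ by $\varepsilon$, or by adding a new edge between $k$ and $t$ with weight $\varepsilon$ (when $\varepsilon>0$), or by removing an edge between $k$ and $t$ with weight $-\varepsilon$ (when $\varepsilon<0$). Unprimed quantities refer to $G$ and primed quantities refer to $G'$, with the same $\alpha$. -}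

module Defs where

open import Level using (_⊔_) renaming (suc to lsuc)
open import Algebra.Apartness.Bundles using (HeytingField)
import Algebra.Apartness.Properties.HeytingCommutativeRing as HeytingProperties
open import Algebra.Bundles using (CommutativeRing)
import Algebra.Definitions as AlgebraDefinitions
import Algebra.Properties.Ring as RingProperties
import Algebra.Properties.Semiring.Sum as SemiringSum
open import Data.Bool.Base using (true; false; if_then_else_)
open import Data.Fin.Base using (Fin; zero; suc)
open import Data.Fin.Properties using (_≟_; suc-injective)
open import Data.List.Base using (List; []; _∷_; map; filter; foldr)
open import Data.List.Properties using (filter-≐)
open import Data.List.Relation.Binary.Permutation.Homogeneous using (Permutation)
open import Data.Nat.Base using (ℕ; zero; suc)
open import Data.Product.Base using (Σ-syntax; _×_; _,_; proj₁; proj₂)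
open import Data.Sum.Base using (_⊎_; inj₁; inj₂; [_,_]′) renaming (swap to ⊎-swap)
open import Data.Vec.Functional using (Vector)
open import Relation.Binary.Core using (Rel)
open import Relation.Binary.PropositionalEquality as ≡ using (_≡_; _≢_)
import Relation.Binary.Reasoning.Setoid as SetoidReasoning
open import Relation.Binary.Structures using (IsStrictPartialOrder)
open import Relation.Nullary.Decidable.Core using (Dec; yes; no; does; _×-dec_; _⊎-dec_)
open import Relation.Nullary.Negation.Core using (¬_; contradiction)

-- The scalars.  The axioms hold for the reals, both classically (with
-- _#_ the negation of equality) and constructively; no decidability of
-- the order is assumed.

record OrderedHeytingField c ℓ₁ ℓ₂ ℓ₃ : Set (lsuc (c ⊔ ℓ₁ ⊔ ℓ₂ ⊔ ℓ₃)) where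
  field
    heytingField : HeytingField c ℓ₁ ℓ₂

  open HeytingField heytingField public

  infix 4 _<_
  field
    _<_                  : Rel Carrier ℓ₃
    isStrictPartialOrder : IsStrictPartialOrder _≈_ _<_
    <⇒#                  : ∀ {x y} → x < y → x # y
    #⇒<∨>                : ∀ {x y} → x # y → x < y ⊎ y < x
    +-monoˡ-<            : ∀ z {x y} → x < y → x + z < y + z
    *-pos                : ∀ {x y} → 0# < x → 0# < y → 0# < x * y

  open IsStrictPartialOrder isStrictPartialOrder public
    using (<-respˡ-≈; <-respʳ-≈)
    renaming (irrefl to <-irrefl; trans to <-trans)

  commutativeRing : CommutativeRing c ℓ₁
  commutativeRing = record { isCommutativeRing = isCommutativeRing }

module OrderedHeytingFieldProperties
  {c ℓ₁ ℓ₂ ℓ₃} (F : OrderedHeytingField c ℓ₁ ℓ₂ ℓ₃) where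

  open OrderedHeytingField F hiding (zero)
  open CommutativeRing commutativeRing using (ring)
  open RingProperties ring
  open HeytingProperties heytingCommutativeRing using (x-0≈x; 1#0; invertibleˡ⇒#; #-congʳ)
  open SetoidReasoning setoid

  neg-pos : ∀ {x} → x < 0# → 0# < - x
  neg-pos {x} x<0 = <-respˡ-≈ (-‿inverseʳ x) (<-respʳ-≈ (+-identityˡ (- x)) (+-monoˡ-< (- x) x<0))

  sq-pos : ∀ {x} → x # 0# → 0# < x * x
  sq-pos {x} x#0 with #⇒<∨> x#0
  ... | inj₂ 0<x = *-pos 0<x 0<x
  ... | inj₁ x<0 = <-respʳ-≈ eq (*-pos (neg-pos x<0) (neg-pos x<0))
    where
    eq : - x * - x ≈ x * x
    eq = begin
      - x * - x      ≈⟨ -‿distribˡ-* x (- x) ⟨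
      - (x * - x)    ≈⟨ -‿cong (-‿distribʳ-* x x) ⟨
      - (- (x * x))  ≈⟨ -‿involutive (x * x) ⟩
      x * x          ∎

  0<1 : 0# < 1#
  0<1 = <-respʳ-≈ (*-identityˡ 1#) (sq-pos 1#0)

  +-pos : ∀ {x y} → 0# < x → 0# < y → 0# < x + y
  +-pos {x} {y} 0<x 0<y = <-trans 0<y (<-respˡ-≈ (+-identityˡ y) (+-monoˡ-< y 0<x))

  2# : Carrier
  2# = 1# + 1#

  2#0 : 2# # 0#
  2#0 = #-sym (<⇒# (+-pos 0<1 0<1))

  -- #⇒invertible yields an inverse of y - 0#, which equals y.
  infixl 7 _/_[_]
  _/_[_] : ∀ x y → y # 0# → Carrier
  x / y [ y#0 ] = x * proj₁ (#⇒invertible y#0)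

  /-inverseʳ : ∀ {y} (y#0 : y # 0#) → y * (1# / y [ y#0 ]) ≈ 1#
  /-inverseʳ {y} y#0 = begin
    y * (1# * _)    ≈⟨ *-congˡ (*-identityˡ _) ⟩
    y * _           ≈⟨ *-congʳ (x-0≈x y) ⟨
    (y - 0#) * _    ≈⟨ proj₂ (proj₂ (#⇒invertible y#0)) ⟩
    1#              ∎

  <-cotrans : ∀ {x y} → x < y → ∀ z → x < z ⊎ z < y
  <-cotrans x<y z with #-cotrans (<⇒# x<y) z
  ... | inj₁ x#z with #⇒<∨> x#z
  ...   | inj₁ x<z = inj₁ x<z
  ...   | inj₂ z<x = inj₂ (<-trans z<x x<y)
  <-cotrans x<y z | inj₂ z#y with #⇒<∨> z#y
  ...   | inj₁ z<y = inj₂ z<y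
  ...   | inj₂ y<z = inj₁ (<-trans x<y y<z)

  NonNegative : Carrier → Set ℓ₃
  NonNegative x = ¬ (x < 0#)

  nonNeg-resp-≈ : ∀ {x y} → x ≈ y → NonNegative x → NonNegative y
  nonNeg-resp-≈ x≈y 0≤x y<0 = 0≤x (<-respˡ-≈ (sym x≈y) y<0)

  0-nonNeg : NonNegative 0#
  0-nonNeg = <-irrefl refl

  pos⇒nonNeg : ∀ {x} → 0# < x → NonNegative x
  pos⇒nonNeg 0<x x<0 = <-irrefl refl (<-trans 0<x x<0)

  pos+nonNeg : ∀ {x y} → 0# < x → NonNegative y → 0# < x + y
  pos+nonNeg {x} {y} 0<x 0≤y with <-cotrans (<-respʳ-≈ refl (+-monoˡ-< y 0<x)) 0#
  ... | inj₁ 0+y<0 = contradiction (<-respˡ-≈ (+-identityˡ y) 0+y<0) 0≤y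
  ... | inj₂ 0<x+y = 0<x+y

  +-nonNeg : ∀ {x y} → NonNegative x → NonNegative y → NonNegative (x + y)
  +-nonNeg {x} {y} 0≤x 0≤y x+y<0 with <-cotrans x+y<0 y
  ... | inj₂ y<0   = 0≤y y<0
  ... | inj₁ x+y<y = 0≤x (<-respˡ-≈ eq (<-respʳ-≈ (-‿inverseʳ y) (+-monoˡ-< (- y) x+y<y)))
    where
    eq : x + y - y ≈ x
    eq = trans (+-assoc x y (- y)) (trans (+-congˡ (-‿inverseʳ y)) (+-identityʳ x))

  x*y#0⇒x#0 : ∀ {x y} → x * y # 0# → x # 0#
  x*y#0⇒x#0 {x} {y} xy#0 = invertibleˡ⇒# (inv * y , eq)
    where
    inv = proj₁ (#⇒invertible xy#0)
    eq : inv * y * (x - 0#) ≈ 1#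
    eq = begin
      inv * y * (x - 0#)  ≈⟨ *-congˡ (x-0≈x x) ⟩
      inv * y * x         ≈⟨ *-assoc inv y x ⟩
      inv * (y * x)       ≈⟨ *-congˡ (*-comm y x) ⟩
      inv * (x * y)       ≈⟨ *-congˡ (x-0≈x (x * y)) ⟨
      inv * (x * y - 0#)  ≈⟨ proj₁ (proj₂ (#⇒invertible xy#0)) ⟩
      1#                  ∎

  nonNeg∧#⇒pos : ∀ {x} → NonNegative x → x # 0# → 0# < x
  nonNeg∧#⇒pos 0≤x x#0 with #⇒<∨> x#0
  ... | inj₁ x<0 = contradiction x<0 0≤x
  ... | inj₂ 0<x = 0<x

  *-nonNeg : ∀ {x y} → NonNegative x → NonNegative y → NonNegative (x * y)
  *-nonNeg {x} {y} 0≤x 0≤y xy<0 = pos⇒nonNeg (*-pos (nonNeg∧#⇒pos 0≤x (x*y#0⇒x#0 xy#0))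
                                                    (nonNeg∧#⇒pos 0≤y (x*y#0⇒x#0 yx#0))) xy<0
    where
    xy#0 = <⇒# xy<0
    yx#0 = #-congʳ (*-comm x y) xy#0

  inverse-pos : ∀ {x} → 0# < x → (x#0 : x # 0#) → 0# < 1# / x [ x#0 ]
  inverse-pos {x} 0<x x#0 = nonNeg∧#⇒pos
    (λ b<0 → pos⇒nonNeg (<-respʳ-≈ -xb≈-1 (*-pos 0<x (neg-pos b<0))) (neg-1))
    (x*y#0⇒x#0 (#-congʳ (trans (sym (/-inverseʳ x#0)) (*-comm x b)) 1#0))
    where
    b = 1# / x [ x#0 ]
    -xb≈-1 : x * - b ≈ - 1#
    -xb≈-1 = trans (sym (-‿distribʳ-* x b)) (-‿cong (/-inverseʳ x#0))
    neg-1 : - 1# < 0#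
    neg-1 = <-respʳ-≈ (-‿inverseʳ 1#) (<-respˡ-≈ (+-identityˡ (- 1#)) (+-monoˡ-< (- 1#) 0<1))

module Matrices {c ℓ₁ ℓ₂ ℓ₃} (F : OrderedHeytingField c ℓ₁ ℓ₂ ℓ₃) where

  open OrderedHeytingField F hiding (zero)
  open OrderedHeytingFieldProperties F
  open CommutativeRing commutativeRing using (ring; semiring)
  open RingProperties ring
  open SemiringSum semiring
  open SetoidReasoning setoid

  Matrix : ℕ → Set c
  Matrix n = Fin n → Fin n → Carrier

  infix  4 _≋_
  infixl 6 _⊕_
  infixl 7 _⊗_
  infixr 8 _⊙_

  _≋_ : ∀ {n} → Rel (Matrix n) ℓ₁
  A ≋ B = ∀ i j → A i j ≈ B i j

  𝟙 : ∀ {n} → Matrix n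
  𝟙 i j = if does (i ≟ j) then 1# else 0#

  _⊕_ : ∀ {n} → Matrix n → Matrix n → Matrix n
  (A ⊕ B) i j = A i j + B i j

  _⊙_ : ∀ {n} → Carrier → Matrix n → Matrix n
  (a ⊙ B) i j = a * B i j

  _⊗_ : ∀ {n} → Matrix n → Matrix n → Matrix n
  _⊗_ {n} A B i j = ∑[ m < n ] (A i m * B m j)

  Invertible : ∀ {n} → Matrix n → Set (c ⊔ ℓ₁)
  Invertible = AlgebraDefinitions.Invertible _≋_ 𝟙 _⊗_

  Symmetric : ∀ {n} → Matrix n → Set ℓ₁
  Symmetric A = ∀ i j → A i j ≈ A j i

  ∑-single : ∀ {n} (i : Fin n) (f : Vector Carrier n) →
             ∑[ j < n ] (if does (i ≟ j) then f j else 0#) ≈ f i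
  ∑-single {suc n} zero    f = trans (+-congˡ (sum-replicate-zero n)) (+-identityʳ (f zero))
  ∑-single {suc n} (suc i) f = trans (+-identityˡ _) (∑-single i (λ j → f (suc j)))

  if-* : ∀ b x → (if b then 1# else 0#) * x ≈ (if b then x else 0#)
  if-* true  x = *-identityˡ x
  if-* false x = zeroˡ x

  𝟙-sym : ∀ {n} → Symmetric (𝟙 {n})
  𝟙-sym zero    zero    = refl
  𝟙-sym zero    (suc j) = refl
  𝟙-sym (suc i) zero    = refl
  𝟙-sym (suc i) (suc j) = 𝟙-sym i j

  ⊗-identityˡ : ∀ {n} (A : Matrix n) → 𝟙 ⊗ A ≋ A
  ⊗-identityˡ {n} A i j = begin
    ∑[ m < n ] (𝟙 i m * A m j)                          ≈⟨ sum-cong-≋ (λ m → if-* (does (i ≟ m)) (A m j)) ⟩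
    ∑[ m < n ] (if does (i ≟ m) then A m j else 0#)     ≈⟨ ∑-single i (λ m → A m j) ⟩
    A i j                                               ∎

  ⊗-identityʳ : ∀ {n} (A : Matrix n) → A ⊗ 𝟙 ≋ A
  ⊗-identityʳ {n} A i j = begin
    ∑[ m < n ] (A i m * 𝟙 m j)  ≈⟨ sum-cong-≋ (λ m → trans (*-comm (A i m) (𝟙 m j)) (*-congʳ (𝟙-sym m j))) ⟩
    ∑[ m < n ] (𝟙 j m * A i m)  ≈⟨ ⊗-identityˡ (λ m i → A i m) j i ⟩
    A i j                       ∎

  ⊗-assoc : ∀ {n} (A B C : Matrix n) → (A ⊗ B) ⊗ C ≋ A ⊗ (B ⊗ C)
  ⊗-assoc {n} A B C i j = begin
    ∑[ m < n ] ((∑[ l < n ] (A i l * B l m)) * C m j)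
      ≈⟨ sum-cong-≋ (λ m → *-distribʳ-sum (C m j) (λ l → A i l * B l m)) ⟩
    ∑[ m < n ] ∑[ l < n ] (A i l * B l m * C m j)
      ≈⟨ ∑-comm (λ m l → A i l * B l m * C m j) ⟩
    ∑[ l < n ] ∑[ m < n ] (A i l * B l m * C m j)
      ≈⟨ sum-cong-≋ (λ l → sum-cong-≋ (λ m → *-assoc (A i l) (B l m) (C m j))) ⟩
    ∑[ l < n ] ∑[ m < n ] (A i l * (B l m * C m j))
      ≈⟨ sum-cong-≋ (λ l → *-distribˡ-sum (A i l) (λ m → B l m * C m j)) ⟨
    ∑[ l < n ] (A i l * ∑[ m < n ] (B l m * C m j)) ∎

  ⊗-cong : ∀ {n} {A B C D : Matrix n} → A ≋ B → C ≋ D → A ⊗ C ≋ B ⊗ D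
  ⊗-cong A≋B C≋D i j = sum-cong-≋ (λ m → *-cong (A≋B i m) (C≋D m j))

  record Dominant {n} (A : Matrix n) : Set ℓ₃ where
    constructor dominant
    field
      off-diagonal : ∀ i j → i ≢ j → NonNegative (- A i j)
      row-sum      : ∀ i → 0# < ∑[ j < n ] A i j

  ∑-nonNeg : ∀ {n} (f : Vector Carrier n) → (∀ i → NonNegative (f i)) → NonNegative (sum f)
  ∑-nonNeg {zero}  f 0≤f = 0-nonNeg
  ∑-nonNeg {suc n} f 0≤f = +-nonNeg (0≤f zero) (∑-nonNeg (λ i → f (suc i)) (λ i → 0≤f (suc i)))

  -‿∑ : ∀ {n} (f : Vector Carrier n) → ∑[ i < n ] (- f i) ≈ - ∑[ i < n ] f i
  -‿∑ {zero}  f = sym -0#≈0#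
  -‿∑ {suc n} f = trans (+-congˡ (-‿∑ (λ i → f (suc i)))) (-‿+-comm (f zero) (∑[ i < n ] f (suc i)))

  x+y-y≈x : ∀ x y → x + y - y ≈ x
  x+y-y≈x x y = trans (+-assoc x y (- y)) (trans (+-congˡ (-‿inverseʳ y)) (+-identityʳ x))

  x-y+y≈x : ∀ x y → x - y + y ≈ x
  x-y+y≈x x y = trans (+-assoc x (- y) y) (trans (+-congˡ (-‿inverseˡ y)) (+-identityʳ x))

  -- One step of Gaussian elimination; the Schur complement of the
  -- leading entry is again dominant.
  module Elimination {n} (A : Matrix (suc n)) (dom : Dominant A) where
    open Dominant dom

    a = A zero zero

    r s : Vector Carrier n
    r j = A zero (suc j)
    s i = A (suc i) zero

    a-pos : 0# < a
    a-pos = <-respʳ-≈ eq (pos+nonNeg (row-sum zero)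
      (∑-nonNeg (λ j → - r j) (λ j → off-diagonal zero (suc j) λ ())))
      where
      eq : a + sum r + ∑[ j < n ] (- r j) ≈ a
      eq = trans (+-congˡ (-‿∑ r)) (x+y-y≈x a (sum r))

    a#0 : a # 0#
    a#0 = #-sym (<⇒# a-pos)

    b = 1# / a [ a#0 ]

    b-pos : 0# < b
    b-pos = inverse-pos a-pos a#0

    ab≈1 : a * b ≈ 1#
    ab≈1 = /-inverseʳ a#0

    schur : Matrix n
    schur i j = A (suc i) (suc j) + - s i * b * r j

    schur-dominant : Dominant schur
    schur-dominant = dominant off row
      where
      off : ∀ i j → i ≢ j → NonNegative (- schur i j)
      off i j i≢j = nonNeg-resp-≈ eq (+-nonNeg
        (off-diagonal (suc i) (suc j) (λ si≡sj → i≢j (suc-injective si≡sj)))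
        (*-nonNeg (*-nonNeg (off-diagonal (suc i) zero λ ()) (pos⇒nonNeg b-pos))
                  (off-diagonal zero (suc j) λ ())))
        where
        eq : - A (suc i) (suc j) + - s i * b * - r j ≈ - schur i j
        eq = trans (+-congˡ (sym (-‿distribʳ-* (- s i * b) (r j))))
                   (-‿+-comm (A (suc i) (suc j)) (- s i * b * r j))

      row : ∀ i → 0# < sum (schur i)
      row i = <-respʳ-≈ eq (pos+nonNeg (row-sum (suc i)) (*-nonNeg
        (*-nonNeg (off-diagonal (suc i) zero λ ()) (pos⇒nonNeg b-pos))
        (pos⇒nonNeg (row-sum zero))))
        where
        B = λ j → A (suc i) (suc j)
        g = - s i * b
        ga≈-s : g * a ≈ - s i
        ga≈-s = begin
          - s i * b * a    ≈⟨ *-assoc (- s i) b a ⟩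
          - s i * (b * a)  ≈⟨ *-congˡ (trans (*-comm b a) ab≈1) ⟩
          - s i * 1#       ≈⟨ *-identityʳ (- s i) ⟩
          - s i            ∎
        eq : s i + sum B + g * (a + sum r) ≈ sum (schur i)
        eq = begin
          s i + sum B + g * (a + sum r)          ≈⟨ +-congˡ (distribˡ g a (sum r)) ⟩
          s i + sum B + (g * a + g * sum r)      ≈⟨ +-cong (+-comm (s i) (sum B)) (+-congʳ ga≈-s) ⟩
          sum B + s i + (- s i + g * sum r)      ≈⟨ +-assoc (sum B + s i) (- s i) (g * sum r) ⟨
          sum B + s i - s i + g * sum r          ≈⟨ +-cong (x+y-y≈x (sum B) (s i)) (*-distribˡ-sum g r) ⟩
          sum B + ∑[ j < n ] (g * r j)           ≈⟨ ∑-distrib-+ B (λ j → g * r j) ⟨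
          sum (schur i)                          ∎

    reduced : Vector Carrier (suc n) → Vector Carrier n
    reduced y i = y (suc i) + - s i * b * y zero

    extend : Vector Carrier (suc n) → Vector Carrier n → Vector Carrier (suc n)
    extend y x zero    = b * (y zero - ∑[ j < n ] (r j * x j))
    extend y x (suc i) = x i

    extend-solves : ∀ y x → (∀ i → ∑[ j < n ] (schur i j * x j) ≈ reduced y i) →
                    ∀ i → ∑[ j < suc n ] (A i j * extend y x j) ≈ y i
    extend-solves y x Sx≈y zero = begin
      a * (b * (y zero - rx)) + rx  ≈⟨ +-congʳ (*-assoc a b (y zero - rx)) ⟨
      a * b * (y zero - rx) + rx    ≈⟨ +-congʳ (*-congʳ ab≈1) ⟩
      1# * (y zero - rx) + rx       ≈⟨ +-congʳ (*-identityˡ (y zero - rx)) ⟩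
      y zero - rx + rx              ≈⟨ x-y+y≈x (y zero) rx ⟩
      y zero                        ∎
      where rx = ∑[ j < n ] (r j * x j)
    extend-solves y x Sx≈y (suc i) = begin
      s i * (b * (y zero - rx)) + Bx          ≈⟨ +-congʳ (trans (sym (*-assoc (s i) b (y zero - rx)))
                                                                (distribˡ (s i * b) (y zero) (- rx))) ⟩
      s i * b * y zero + s i * b * - rx + Bx  ≈⟨ +-congʳ (+-congˡ flip) ⟩
      s i * b * y zero + g * rx + Bx          ≈⟨ trans (+-assoc _ _ _) (+-congˡ (+-comm (g * rx) Bx)) ⟩
      s i * b * y zero + (Bx + g * rx)        ≈⟨ +-congˡ Sx ⟨
      s i * b * y zero + ∑[ j < n ] (schur i j * x j)
                                              ≈⟨ +-congˡ (Sx≈y i) ⟩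
      s i * b * y zero + (y (suc i) + g * y zero)
                                              ≈⟨ trans (+-comm _ _) (trans (+-assoc _ _ _) (+-congˡ cancel)) ⟩
      y (suc i) + 0#                          ≈⟨ +-identityʳ (y (suc i)) ⟩
      y (suc i)                               ∎
      where
      rx = ∑[ j < n ] (r j * x j)
      Bx = ∑[ j < n ] (A (suc i) (suc j) * x j)
      g  = - s i * b
      g≈ : g ≈ - (s i * b)
      g≈ = sym (-‿distribˡ-* (s i) b)
      flip : s i * b * - rx ≈ g * rx
      flip = trans (sym (-‿distribʳ-* (s i * b) rx)) (trans (-‿distribˡ-* (s i * b) rx) (*-congʳ (sym g≈)))
      cancel : g * y zero + s i * b * y zero ≈ 0#
      cancel = begin
        g * y zero + s i * b * y zero  ≈⟨ distribʳ (y zero) g (s i * b) ⟨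
        (g + s i * b) * y zero         ≈⟨ *-congʳ (trans (+-congʳ g≈) (-‿inverseˡ (s i * b))) ⟩
        0# * y zero                    ≈⟨ zeroˡ (y zero) ⟩
        0#                             ∎
      Sx : ∑[ j < n ] (schur i j * x j) ≈ Bx + g * rx
      Sx = begin
        ∑[ j < n ] ((A (suc i) (suc j) + g * r j) * x j)
          ≈⟨ sum-cong-≋ (λ j → trans (distribʳ (x j) _ _) (+-congˡ (*-assoc g (r j) (x j)))) ⟩
        ∑[ j < n ] (A (suc i) (suc j) * x j + g * (r j * x j))
          ≈⟨ ∑-distrib-+ (λ j → A (suc i) (suc j) * x j) (λ j → g * (r j * x j)) ⟩
        Bx + ∑[ j < n ] (g * (r j * x j))
          ≈⟨ +-congˡ (*-distribˡ-sum g (λ j → r j * x j)) ⟨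
        Bx + g * rx ∎

  dominant⇒solvable : ∀ {n} (A : Matrix n) → Dominant A → (y : Vector Carrier n) →
                      Σ[ x ∈ Vector Carrier n ] (∀ i → ∑[ j < n ] (A i j * x j) ≈ y i)
  dominant⇒solvable {zero}  A dom y = y , λ ()
  dominant⇒solvable {suc n} A dom y =
    let x , Sx≈y = dominant⇒solvable schur schur-dominant (reduced y)
    in  extend y x , extend-solves y x Sx≈y
    where open Elimination A dom

  symmetric∧dominant⇒invertible : ∀ {n} (A : Matrix n) → Symmetric A → Dominant A → Invertible A
  symmetric∧dominant⇒invertible {n} A A-sym dom = X , XA≋𝟙 , AX≋𝟙
    where
    X Xᵀ : Matrix n
    X i j = proj₁ (dominant⇒solvable A dom (λ l → 𝟙 l j)) i
    Xᵀ i j = X j i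

    AX≋𝟙 : A ⊗ X ≋ 𝟙
    AX≋𝟙 i j = proj₂ (dominant⇒solvable A dom (λ l → 𝟙 l j)) i

    XᵀA≋𝟙 : Xᵀ ⊗ A ≋ 𝟙
    XᵀA≋𝟙 i j = begin
      ∑[ m < n ] (X m i * A m j)  ≈⟨ sum-cong-≋ (λ m → trans (*-comm (X m i) (A m j)) (*-congʳ (A-sym m j))) ⟩
      ∑[ m < n ] (A j m * X m i)  ≈⟨ AX≋𝟙 j i ⟩
      𝟙 j i                       ≈⟨ 𝟙-sym j i ⟩
      𝟙 i j                       ∎

    X≋Xᵀ : X ≋ Xᵀ
    X≋Xᵀ i j = begin
      X i j               ≈⟨ ⊗-identityˡ X i j ⟨
      (𝟙 ⊗ X) i j         ≈⟨ ⊗-cong {C = X} XᵀA≋𝟙 (λ _ _ → refl) i j ⟨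
      (Xᵀ ⊗ A ⊗ X) i j    ≈⟨ ⊗-assoc Xᵀ A X i j ⟩
      (Xᵀ ⊗ (A ⊗ X)) i j  ≈⟨ ⊗-cong {A = Xᵀ} (λ _ _ → refl) AX≋𝟙 i j ⟩
      (Xᵀ ⊗ 𝟙) i j        ≈⟨ ⊗-identityʳ Xᵀ i j ⟩
      Xᵀ i j              ∎

    XA≋𝟙 : X ⊗ A ≋ 𝟙
    XA≋𝟙 i j = trans (⊗-cong {C = A} X≋Xᵀ (λ _ _ → refl) i j) (XᵀA≋𝟙 i j)

module WeightedMultigraphs {c ℓ₁ ℓ₂ ℓ₃} (F : OrderedHeytingField c ℓ₁ ℓ₂ ℓ₃) where

  open OrderedHeytingField F hiding (zero)
  open OrderedHeytingFieldProperties F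
  open Matrices F
  open CommutativeRing commutativeRing using (ring; semiring)
  open RingProperties ring
  open SemiringSum semiring
  open SetoidReasoning setoid

  record Edge (n : ℕ) : Set (c ⊔ ℓ₃) where
    field
      end₁ end₂  : Fin n
      loopless   : end₁ ≢ end₂
      weight     : Carrier
      weight-pos : 0# < weight

  open Edge public

  -- Edges are undirected: the order of the two ends is immaterial.
  Joins : ∀ {n} → Fin n → Fin n → Edge n → Set
  Joins i j e = (end₁ e ≡ i × end₂ e ≡ j) ⊎ (end₁ e ≡ j × end₂ e ≡ i)

  joins? : ∀ {n} (i j : Fin n) (e : Edge n) → Dec (Joins i j e)
  joins? i j e = (end₁ e ≟ i ×-dec end₂ e ≟ j) ⊎-dec (end₁ e ≟ j ×-dec end₂ e ≟ i)

  infix 4 _≈ₑ_ _≅_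

  _≈ₑ_ : ∀ {n} → Rel (Edge n) ℓ₁
  e ≈ₑ f = Joins (end₁ f) (end₂ f) e × weight e ≈ weight f

  Multigraph : ℕ → Set (c ⊔ ℓ₃)
  Multigraph n = List (Edge n)

  -- Equality of multisets of edges.
  _≅_ : ∀ {n} → Rel (Multigraph n) (c ⊔ ℓ₁ ⊔ ℓ₃)
  _≅_ = Permutation _≈ₑ_

  totalWeight : ∀ {n} → Multigraph n → Fin n → Fin n → Carrier
  totalWeight G i j = foldr _+_ 0# (map weight (filter (joins? i j) G))

  offDiagonal : ∀ {n} → Multigraph n → Matrix n
  offDiagonal G i j = if does (i ≟ j) then 0# else - totalWeight G i j

  laplacian : ∀ {n} → Multigraph n → Matrix n
  laplacian {n} G i j =
    if does (i ≟ j) then - ∑[ m < n ] offDiagonal G i m else offDiagonal G i j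

  totalWeight-sym : ∀ {n} (G : Multigraph n) i j → totalWeight G i j ≈ totalWeight G j i
  totalWeight-sym G i j = reflexive (≡.cong (λ H → foldr _+_ 0# (map weight H))
    (filter-≐ (joins? i j) (joins? j i) (⊎-swap , ⊎-swap) G))

  totalWeight-nonNeg : ∀ {n} (G : Multigraph n) i j → NonNegative (totalWeight G i j)
  totalWeight-nonNeg G i j = weights-nonNeg (filter (joins? i j) G)
    where
    weights-nonNeg : ∀ H → NonNegative (foldr _+_ 0# (map weight H))
    weights-nonNeg []      = 0-nonNeg
    weights-nonNeg (e ∷ H) = +-nonNeg (pos⇒nonNeg (weight-pos e)) (weights-nonNeg H)

  laplacian-sym : ∀ {n} (G : Multigraph n) → Symmetric (laplacian G)
  laplacian-sym G i j with i ≟ j | j ≟ i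
  ... | yes ≡.refl | yes _ = refl
  ... | no  _      | no  _ = -‿cong (totalWeight-sym G i j)
  ... | yes i≡j    | no j≢i = contradiction (≡.sym i≡j) j≢i
  ... | no i≢j     | yes j≡i = contradiction (≡.sym j≡i) i≢j

  laplacian-row : ∀ {n} (G : Multigraph n) i → ∑[ j < n ] laplacian G i j ≈ 0#
  laplacian-row {n} G i = begin
    ∑[ j < n ] laplacian G i j                             ≈⟨ sum-cong-≋ split ⟩
    ∑[ j < n ] ((if does (i ≟ j) then - o else 0#) + offDiagonal G i j)
                                                           ≈⟨ ∑-distrib-+ (λ j → if does (i ≟ j) then - o else 0#) (offDiagonal G i) ⟩
    ∑[ j < n ] (if does (i ≟ j) then - o else 0#) + o      ≈⟨ +-congʳ (∑-single i (λ _ → - o)) ⟩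
    - o + o                                                ≈⟨ -‿inverseˡ o ⟩
    0#                                                     ∎
    where
    o = ∑[ m < n ] offDiagonal G i m
    split : ∀ j → laplacian G i j ≈ (if does (i ≟ j) then - o else 0#) + offDiagonal G i j
    split j with does (i ≟ j)
    ... | true  = sym (+-identityʳ (- o))
    ... | false = sym (+-identityˡ _)

  -- In the first case ε may have either sign, as long as the new weight
  -- is still positive.
  data DiffersInEdge {n} (k t : Fin n) (ε : Carrier) (G G′ : Multigraph n) : Set (c ⊔ ℓ₁ ⊔ ℓ₃) where
    reweighted : ∀ (e e′ : Edge n) (H : Multigraph n) → G ≅ e ∷ H → G′ ≅ e′ ∷ H →
                 Joins k t e → Joins k t e′ → weight e′ ≈ weight e + ε →
                 DiffersInEdge k t ε G G′
    added      : ∀ (e : Edge n) → 0# < ε → G′ ≅ e ∷ G →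
                 Joins k t e → weight e ≈ ε →
                 DiffersInEdge k t ε G G′
    removed    : ∀ (e : Edge n) → ε < 0# → G ≅ e ∷ G′ →
                 Joins k t e → weight e ≈ - ε →
                 DiffersInEdge k t ε G G′

  module ForestMetric (α : Carrier) (α>0 : 0# < α) {n : ℕ} (G : Multigraph n) where

    𝟙+αL : Matrix n
    𝟙+αL = 𝟙 ⊕ α ⊙ laplacian G

    abstract
      𝟙+αL-invertible : Invertible 𝟙+αL
      𝟙+αL-invertible = symmetric∧dominant⇒invertible 𝟙+αL
        (λ i j → +-cong (𝟙-sym i j) (*-congˡ (laplacian-sym G i j)))
        (dominant off row)
        where
        off : ∀ i j → i ≢ j → NonNegative (- 𝟙+αL i j)
        off i j i≢j with i ≟ j
        ... | yes i≡j = contradiction i≡j i≢j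
        ... | no  _   = nonNeg-resp-≈ eq (*-nonNeg (pos⇒nonNeg α>0) (totalWeight-nonNeg G i j))
          where
          w : Carrier
          w = totalWeight G i j
          eq : α * w ≈ - (0# + α * - w)
          eq = begin
            α * w             ≈⟨ *-congˡ (-‿involutive w) ⟨
            α * - - w         ≈⟨ -‿distribʳ-* α (- w) ⟨
            - (α * - w)       ≈⟨ -‿cong (+-identityˡ (α * - w)) ⟨
            - (0# + α * - w)  ∎

        row : ∀ i → 0# < ∑[ j < n ] 𝟙+αL i j
        row i = <-respʳ-≈ (sym eq) 0<1
          where
          eq : ∑[ j < n ] 𝟙+αL i j ≈ 1#
          eq = begin
            ∑[ j < n ] 𝟙+αL i j                                   ≈⟨ ∑-distrib-+ (𝟙 i) (λ j → α * laplacian G i j) ⟩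
            ∑[ j < n ] 𝟙 i j + ∑[ j < n ] (α * laplacian G i j)   ≈⟨ +-cong (∑-single i (λ _ → 1#)) (sym (*-distribˡ-sum α (laplacian G i))) ⟩
            1# + α * ∑[ j < n ] laplacian G i j                   ≈⟨ +-congˡ (*-congˡ (laplacian-row G i)) ⟩
            1# + α * 0#                                           ≈⟨ trans (+-congˡ (zeroʳ α)) (+-identityʳ 1#) ⟩
            1#                                                    ∎

    q : Matrix n
    q = proj₁ 𝟙+αL-invertible

    d : Matrix n
    d i j = 1# / 2# [ 2#0 ] * (q i i + q j j - q i j - q j i)

    τ : Fin n → Fin n → Fin n → Carrier
    τ i k t = d i k - d i t

    π : Fin n → Fin n → Fin n → Carrier
    π i k t = q i k - q i t

-- Since L(G) is the sum of w_e b_e b_eᵀ over the edges e, where b_e is the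
-- difference of the indicators of the ends of e, passing from G to G′ is
-- the rank-one update W′ = W + αε b bᵀ of W = I + αL, with b = e_k - e_t.
-- From Q = Q′ W′ Q one reads off q = q′ + αε π′_i π_j, and differences of
-- this identity give π′_i d_kt = π_i d′_kt.  Finally 2 d_kt = bᵀQb is the
-- value at x = Qb of the quadratic form of W, which is at least the sum of
-- the squares of the entries of x; some entry is nonzero because Wx = b.
module Submission where

open import Defs
open import Algebra.Bundles using (CommutativeRing; RawRing)
import Algebra.Apartness.Properties.HeytingCommutativeRing as HeytingProperties
import Algebra.Properties.Ring as RingProperties
import Algebra.Properties.Semiring.Mult.TCOptimised as Mult
import Algebra.Properties.Semiring.Sum as SemiringSum
import Algebra.Solver.Ring
open import Algebra.Solver.Ring.AlmostCommutativeRing using (fromCommutativeRing; _-Raw-AlmostCommutative⟶_)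
open import Data.Bool.Base using (true; false; if_then_else_)
open import Data.Fin.Base using (Fin; zero; suc)
open import Data.Fin.Properties using (_≟_)
open import Data.Integer.Base as ℤ using (ℤ; +_; -[1+_]; _⊖_; _◃_)
import Data.Integer.Properties as ℤₚ
open import Data.List.Base using ([]; _∷_)
import Data.List.Relation.Binary.Permutation.Homogeneous as Perm
open import Data.List.Relation.Binary.Pointwise.Base using (Pointwise; []; _∷_)
open import Data.Maybe.Base as Maybe using (Maybe)
open import Data.Nat.Base as ℕ using (ℕ; zero; suc)
open import Data.Nat.Properties using (+-suc)
open import Data.Product.Base using (Σ-syntax; _×_; _,_; proj₁; proj₂)
import Data.Sign.Base as Sign
open import Data.Sum.Base using (inj₁; inj₂)
open import Data.Vec.Functional using (Vector)
open import Relation.Binary.PropositionalEquality as ≡ using (_≡_; _≢_)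
import Relation.Binary.Reasoning.Setoid as SetoidReasoning
open import Relation.Nullary.Decidable.Core using (yes; no; does; dec⇒maybe)
open import Relation.Nullary.Negation.Core using (contradiction)

-- Ring normalisation with integer coefficients.

-- The solver needs coefficients with a decidable equality in order to
-- detect cancellation, which the carrier of R does not provide.
module IntegerCoefficients {c ℓ} (R : CommutativeRing c ℓ) where

  open CommutativeRing R hiding (zero)
  open RingProperties ring
  open Mult semiring using (1+×; ×-homo-+; ×1-homo-*) renaming (_×_ to _×ₙ_)
  open SetoidReasoning setoid

  ⟦_⟧ᶻ : ℤ → Carrier
  ⟦ + n ⟧ᶻ      = n ×ₙ 1#
  ⟦ -[1+ n ] ⟧ᶻ = - (suc n ×ₙ 1#)

  -- `⊖` cancels one successor on each side. The carrier side follows suit by inserting `1# - 1#`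
  -- and absorbing one unit into each multiple.
  ⊖-homo : ∀ m n → ⟦ m ⊖ n ⟧ᶻ ≈ m ×ₙ 1# - n ×ₙ 1#
  ⊖-homo m       zero    = sym (trans (+-congˡ -0#≈0#) (+-identityʳ _))
  ⊖-homo zero    (suc n) = sym (+-identityˡ _)
  ⊖-homo (suc m) (suc n) = begin
    ⟦ suc m ⊖ suc n ⟧ᶻ                  ≡⟨ ≡.cong ⟦_⟧ᶻ (ℤₚ.[1+m]⊖[1+n]≡m⊖n m n) ⟩
    ⟦ m ⊖ n ⟧ᶻ                          ≈⟨ ⊖-homo m n ⟩
    m′ - n′                             ≈⟨ +-congˡ (+-identityˡ (- n′)) ⟨
    m′ + (0# - n′)                      ≈⟨ +-congˡ (+-congʳ (-‿inverseʳ 1#)) ⟨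
    m′ + (1# - 1# - n′)                 ≈⟨ +-congˡ (trans (+-assoc _ _ _) (+-congˡ (-‿+-comm 1# n′))) ⟩
    m′ + (1# - (1# + n′))               ≈⟨ trans (sym (+-assoc _ _ _)) (+-congʳ (+-comm m′ 1#)) ⟩
    1# + m′ - (1# + n′)                 ≈⟨ +-cong (1+× m 1#) (-‿cong (1+× n 1#)) ⟨
    suc m ×ₙ 1# - suc n ×ₙ 1#           ∎
    where
    m′ = m ×ₙ 1#
    n′ = n ×ₙ 1#

  +ᶻ-homo : ∀ x y → ⟦ x ℤ.+ y ⟧ᶻ ≈ ⟦ x ⟧ᶻ + ⟦ y ⟧ᶻ
  +ᶻ-homo (+ m)      (+ n)      = ×-homo-+ 1# m n
  +ᶻ-homo (+ m)      -[1+ n ]   = ⊖-homo m (suc n)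
  +ᶻ-homo -[1+ m ]   (+ n)      = trans (⊖-homo n (suc m)) (+-comm _ _)
  +ᶻ-homo -[1+ m ]   -[1+ n ]   = begin
    - (suc (suc (m ℕ.+ n)) ×ₙ 1#)      ≡⟨ ≡.cong (λ l → - (suc l ×ₙ 1#)) (+-suc m n) ⟨
    - ((suc m ℕ.+ suc n) ×ₙ 1#)        ≈⟨ -‿cong (×-homo-+ 1# (suc m) (suc n)) ⟩
    - (suc m ×ₙ 1# + suc n ×ₙ 1#)      ≈⟨ -‿+-comm _ _ ⟨
    - (suc m ×ₙ 1#) - suc n ×ₙ 1#      ∎

  +◃-homo : ∀ n → ⟦ Sign.+ ◃ n ⟧ᶻ ≈ n ×ₙ 1#
  +◃-homo zero    = refl
  +◃-homo (suc n) = refl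

  -◃-homo : ∀ n → ⟦ Sign.- ◃ n ⟧ᶻ ≈ - (n ×ₙ 1#)
  -◃-homo zero    = sym -0#≈0#
  -◃-homo (suc n) = refl

  *ᶻ-homo : ∀ x y → ⟦ x ℤ.* y ⟧ᶻ ≈ ⟦ x ⟧ᶻ * ⟦ y ⟧ᶻ
  *ᶻ-homo (+ m)    (+ n)    = trans (+◃-homo (m ℕ.* n)) (×1-homo-* m n)
  *ᶻ-homo (+ m)    -[1+ n ] = trans (-◃-homo (m ℕ.* suc n)) (trans (-‿cong (×1-homo-* m (suc n))) (-‿distribʳ-* _ _))
  *ᶻ-homo -[1+ m ] (+ n)    = trans (-◃-homo (suc m ℕ.* n)) (trans (-‿cong (×1-homo-* (suc m) n)) (-‿distribˡ-* _ _))
  *ᶻ-homo -[1+ m ] -[1+ n ] = trans (×1-homo-* (suc m) (suc n))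
    (sym (trans (sym (-‿distribˡ-* _ _)) (trans (-‿cong (sym (-‿distribʳ-* _ _))) (-‿involutive _))))

  -ᶻ-homo : ∀ x → ⟦ ℤ.- x ⟧ᶻ ≈ - ⟦ x ⟧ᶻ
  -ᶻ-homo (+ zero)  = sym -0#≈0#
  -ᶻ-homo (+ suc n) = refl
  -ᶻ-homo -[1+ n ]  = sym (-‿involutive _)

  ℤ-rawRing : RawRing _ _
  ℤ-rawRing = record
    { _≈_ = _≡_; _+_ = ℤ._+_; _*_ = ℤ._*_; -_ = ℤ.-_; 0# = ℤ.0ℤ; 1# = ℤ.1ℤ }

  homomorphism : ℤ-rawRing -Raw-AlmostCommutative⟶ fromCommutativeRing R
  homomorphism = record
    { ⟦_⟧    = ⟦_⟧ᶻ
    ; +-homo = +ᶻ-homo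
    ; *-homo = *ᶻ-homo
    ; -‿homo = -ᶻ-homo
    ; 0-homo = refl
    ; 1-homo = refl
    }

  -- Integers are compared, not their images. Distinct integers with equal images only yield
  -- `nothing`, which costs the solver a cancellation but not its soundness.
  coeff≟ : ∀ x y → Maybe (⟦ x ⟧ᶻ ≈ ⟦ y ⟧ᶻ)
  coeff≟ x y = Maybe.map (λ x≡y → reflexive (≡.cong ⟦_⟧ᶻ x≡y)) (dec⇒maybe (x ℤₚ.≟ y))

  open Algebra.Solver.Ring ℤ-rawRing (fromCommutativeRing R) homomorphism coeff≟ public
    using (solve; _:=_; _:+_; _:-_; _:*_; :-_; con)

-- Positivity of sums, rank-one updates of inverses, and quadratic forms.

module FormsAndUpdates {c ℓ₁ ℓ₂ ℓ₃} (F : OrderedHeytingField c ℓ₁ ℓ₂ ℓ₃) where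

  open OrderedHeytingField F hiding (zero)
  open OrderedHeytingFieldProperties F
  open Matrices F
  open CommutativeRing commutativeRing using (ring; semiring)
  open RingProperties ring
  open SemiringSum semiring
  open IntegerCoefficients commutativeRing
  open SetoidReasoning setoid

  -- The sign of `x` cannot be decided, but the goal is a negation: a negative square is apart from
  -- zero, hence so is `x`, and then its square is positive.
  sq-nonNeg : ∀ x → NonNegative (x * x)
  sq-nonNeg x xx<0 = pos⇒nonNeg (sq-pos (x*y#0⇒x#0 (<⇒# xx<0))) xx<0

  ∑-pos : ∀ {n} (f : Vector Carrier n) → (∀ i → NonNegative (f i)) → ∀ i → 0# < f i → 0# < sum f
  ∑-pos f 0≤f zero    0<fi = pos+nonNeg 0<fi (∑-nonNeg _ (λ i → 0≤f (suc i)))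
  ∑-pos f 0≤f (suc i) 0<fi =
    <-respʳ-≈ (+-comm _ _) (pos+nonNeg (∑-pos _ (λ j → 0≤f (suc j)) i 0<fi) (0≤f zero))

  -- Cotransitivity of `<` replaces a sign test. The tail sum lies between neither or one of the two
  -- bounds: it is positive, or it is below the total, which makes the head positive.
  0<∑⇒∃ : ∀ {n} (f : Vector Carrier n) → 0# < sum f → Σ[ i ∈ Fin n ] 0# < f i
  0<∑⇒∃ {zero}  f 0<0 = contradiction 0<0 (<-irrefl refl)
  0<∑⇒∃ {suc n} f 0<∑ with <-cotrans 0<∑ (∑[ i < n ] f (suc i))
  ... | inj₁ 0<s = let i , 0<fi = 0<∑⇒∃ (λ i → f (suc i)) 0<s in suc i , 0<fi
  ... | inj₂ s<∑ = zero , <-respˡ-≈ (-‿inverseʳ s) (<-respʳ-≈ (x+y-y≈x (f zero) s) (+-monoˡ-< (- s) s<∑))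
    where s = ∑[ i < n ] f (suc i)

  outer : ∀ {n} → Carrier → Vector Carrier n → Matrix n
  outer c u i j = c * (u i * u j)

  ∑-outer : ∀ {n} c (u x : Vector Carrier n) i →
            ∑[ j < n ] (outer c u i j * x j) ≈ c * u i * ∑[ j < n ] (u j * x j)
  ∑-outer {n} c u x i = begin
    ∑[ j < n ] (c * (u i * u j) * x j)
      ≈⟨ sum-cong-≋ (λ j → solve 4 (λ c a b x → c :* (a :* b) :* x := c :* a :* (b :* x)) refl c (u i) (u j) (x j)) ⟩
    ∑[ j < n ] (c * u i * (u j * x j))
      ≈⟨ *-distribˡ-sum (c * u i) (λ j → u j * x j) ⟨
    c * u i * ∑[ j < n ] (u j * x j) ∎

  -- Transposing a left inverse of a symmetric matrix gives a right inverse, and a left and a right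
  -- inverse coincide.
  inverse-sym : ∀ {n} {A X : Matrix n} → Symmetric A → X ⊗ A ≋ 𝟙 → A ⊗ X ≋ 𝟙 → Symmetric X
  inverse-sym {n} {A} {X} A-sym XA≋𝟙 AX≋𝟙 i j = begin
    X i j               ≈⟨ ⊗-identityʳ X i j ⟨
    (X ⊗ 𝟙) i j         ≈⟨ ⊗-cong {A = X} (λ _ _ → refl) AXᵀ≋𝟙 i j ⟨
    (X ⊗ (A ⊗ Xᵀ)) i j  ≈⟨ ⊗-assoc X A Xᵀ i j ⟨
    (X ⊗ A ⊗ Xᵀ) i j    ≈⟨ ⊗-cong {C = Xᵀ} XA≋𝟙 (λ _ _ → refl) i j ⟩
    (𝟙 ⊗ Xᵀ) i j        ≈⟨ ⊗-identityˡ Xᵀ i j ⟩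
    Xᵀ i j              ∎
    where
    Xᵀ : Matrix n
    Xᵀ i j = X j i
    AXᵀ≋𝟙 : A ⊗ Xᵀ ≋ 𝟙
    AXᵀ≋𝟙 i j = begin
      ∑[ m < n ] (A i m * X j m)  ≈⟨ sum-cong-≋ (λ m → trans (*-comm _ _) (*-congˡ (A-sym i m))) ⟩
      (X ⊗ A) j i                 ≈⟨ XA≋𝟙 j i ⟩
      𝟙 j i                       ≈⟨ 𝟙-sym j i ⟩
      𝟙 i j                       ∎

  -- Expand `X ⊗ B ⊗ Y` with `B` written as A + c u uᵀ. Mixing the inverses of both matrices avoids
  -- the division in the Sherman-Morrison formula.
  resolvent : ∀ {n} {A B X Y : Matrix n} {c u} → B ≋ A ⊕ outer c u → X ⊗ B ≋ 𝟙 → A ⊗ Y ≋ 𝟙 →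
              ∀ i j → Y i j ≈ X i j + c * (∑[ m < n ] (X i m * u m) * ∑[ m < n ] (u m * Y m j))
  resolvent {n} {A} {B} {X} {Y} {c} {u} B≋ XB≋𝟙 AY≋𝟙 i j = begin
    Y i j                                       ≈⟨ ⊗-identityˡ Y i j ⟨
    (𝟙 ⊗ Y) i j                                 ≈⟨ ⊗-cong {C = Y} XB≋𝟙 (λ _ _ → refl) i j ⟨
    (X ⊗ B ⊗ Y) i j                             ≈⟨ ⊗-assoc X B Y i j ⟩
    (X ⊗ (B ⊗ Y)) i j                           ≈⟨ sum-cong-≋ (λ l → trans (*-congˡ (BY l)) (distribˡ _ _ _)) ⟩
    ∑[ l < n ] (X i l * 𝟙 l j + X i l * (c * u l * v))
                                                ≈⟨ ∑-distrib-+ (λ l → X i l * 𝟙 l j) (λ l → X i l * (c * u l * v)) ⟩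
    (X ⊗ 𝟙) i j + ∑[ l < n ] (X i l * (c * u l * v))
                                                ≈⟨ +-cong (⊗-identityʳ X i j) (sum-cong-≋ (λ l →
                                                     solve 4 (λ x c u v → x :* (c :* u :* v) := c :* v :* (x :* u)) refl (X i l) c (u l) v)) ⟩
    X i j + ∑[ l < n ] (c * v * (X i l * u l))  ≈⟨ +-congˡ (*-distribˡ-sum (c * v) (λ l → X i l * u l)) ⟨
    X i j + c * v * s                           ≈⟨ +-congˡ (trans (*-assoc c v s) (*-congˡ (*-comm v s))) ⟩
    X i j + c * (s * v)                         ∎
    where
    s = ∑[ m < n ] (X i m * u m)
    v = ∑[ m < n ] (u m * Y m j)
    BY : ∀ l → (B ⊗ Y) l j ≈ 𝟙 l j + c * u l * v
    BY l = begin
      (B ⊗ Y) l j                       ≈⟨ sum-cong-≋ (λ m → trans (*-congʳ (B≋ l m)) (distribʳ _ _ _)) ⟩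
      ∑[ m < n ] (A l m * Y m j + outer c u l m * Y m j)
                                        ≈⟨ ∑-distrib-+ (λ m → A l m * Y m j) (λ m → outer c u l m * Y m j) ⟩
      (A ⊗ Y) l j + ∑[ m < n ] (outer c u l m * Y m j)
                                        ≈⟨ +-cong (AY≋𝟙 l j) (∑-outer c u (λ m → Y m j) l) ⟩
      𝟙 l j + c * u l * v               ∎

  -- The quadratic form xᵀAx, with the product Ax kept as an inner factor so that a known value of
  -- Ax can be substituted.
  form : ∀ {n} → Matrix n → Vector Carrier n → Carrier
  form {n} A x = ∑[ i < n ] (x i * ∑[ j < n ] (A i j * x j))

  form-cong : ∀ {n} {A B : Matrix n} → A ≋ B → ∀ x → form A x ≈ form B x
  form-cong A≋B x = sum-cong-≋ (λ i → *-congˡ (sum-cong-≋ (λ j → *-congʳ (A≋B i j))))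

  form-⊕ : ∀ {n} (A B : Matrix n) x → form (A ⊕ B) x ≈ form A x + form B x
  form-⊕ {n} A B x = begin
    form (A ⊕ B) x
      ≈⟨ sum-cong-≋ (λ i → trans
           (*-congˡ (trans (sum-cong-≋ (λ j → distribʳ (x j) (A i j) (B i j)))
                           (∑-distrib-+ (λ j → A i j * x j) (λ j → B i j * x j))))
           (distribˡ _ _ _)) ⟩
    ∑[ i < n ] (x i * ∑[ j < n ] (A i j * x j) + x i * ∑[ j < n ] (B i j * x j))
      ≈⟨ ∑-distrib-+ (λ i → x i * ∑[ j < n ] (A i j * x j)) (λ i → x i * ∑[ j < n ] (B i j * x j)) ⟩
    form A x + form B x ∎

  form-⊙ : ∀ {n} a (A : Matrix n) x → form (a ⊙ A) x ≈ a * form A x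
  form-⊙ {n} a A x = begin
    form (a ⊙ A) x
      ≈⟨ sum-cong-≋ (λ i → *-congˡ (trans (sum-cong-≋ (λ j → *-assoc a (A i j) (x j)))
                                          (sym (*-distribˡ-sum a (λ j → A i j * x j))))) ⟩
    ∑[ i < n ] (x i * (a * ∑[ j < n ] (A i j * x j)))
      ≈⟨ sum-cong-≋ (λ i → solve 3 (λ x a s → x :* (a :* s) := a :* (x :* s)) refl (x i) a (∑[ j < n ] (A i j * x j))) ⟩
    ∑[ i < n ] (a * (x i * ∑[ j < n ] (A i j * x j)))
      ≈⟨ *-distribˡ-sum a (λ i → x i * ∑[ j < n ] (A i j * x j)) ⟨
    a * form A x ∎

  form-𝟙 : ∀ {n} (x : Vector Carrier n) → form 𝟙 x ≈ ∑[ i < n ] (x i * x i)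
  -- The vector is viewed as a matrix all of whose columns are `x`.
  form-𝟙 x = sum-cong-≋ (λ i → *-congˡ (⊗-identityˡ (λ m _ → x m) i i))

  form-outer : ∀ {n} c (u x : Vector Carrier n) →
               form (outer c u) x ≈ c * (∑[ j < n ] (u j * x j) * ∑[ j < n ] (u j * x j))
  form-outer {n} c u x = begin
    form (outer c u) x                  ≈⟨ sum-cong-≋ (λ i → *-congˡ (∑-outer c u x i)) ⟩
    ∑[ i < n ] (x i * (c * u i * s))    ≈⟨ sum-cong-≋ (λ i →
                                             solve 4 (λ x c u s → x :* (c :* u :* s) := c :* s :* (u :* x)) refl (x i) c (u i) s) ⟩
    ∑[ i < n ] (c * s * (u i * x i))    ≈⟨ *-distribˡ-sum (c * s) (λ i → u i * x i) ⟨
    c * s * s                           ≈⟨ *-assoc c s s ⟩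
    c * (s * s)                         ∎
    where s = ∑[ j < n ] (u j * x j)

  -- The vector b = e_k - e_t; pairing with it takes the difference of two entries.
  δ : ∀ {n} → Fin n → Fin n → Vector Carrier n
  δ k t m = 𝟙 k m - 𝟙 t m

  ∑-δ : ∀ {n} k t (f : Vector Carrier n) → ∑[ m < n ] (δ k t m * f m) ≈ f k - f t
  ∑-δ {n} k t f = begin
    ∑[ m < n ] (δ k t m * f m)
      ≈⟨ sum-cong-≋ (λ m → [y-z]x≈yx-zx (f m) (𝟙 k m) (𝟙 t m)) ⟩
    ∑[ m < n ] (𝟙 k m * f m - 𝟙 t m * f m)
      ≈⟨ ∑-distrib-+ (λ m → 𝟙 k m * f m) (λ m → - (𝟙 t m * f m)) ⟩
    ∑[ m < n ] (𝟙 k m * f m) + ∑[ m < n ] (- (𝟙 t m * f m))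
      ≈⟨ +-cong (∑𝟙 k) (trans (-‿∑ (λ m → 𝟙 t m * f m)) (-‿cong (∑𝟙 t))) ⟩
    f k - f t ∎
    where
    ∑𝟙 : ∀ l → ∑[ m < n ] (𝟙 l m * f m) ≈ f l
    ∑𝟙 l = ⊗-identityˡ (λ m _ → f m) l l

  𝟙-diag : ∀ {n} (i : Fin n) → 𝟙 i i ≈ 1#
  𝟙-diag i with i ≟ i
  ... | yes _  = refl
  ... | no i≢i = contradiction ≡.refl i≢i

  𝟙-off : ∀ {n} {i j : Fin n} → i ≢ j → 𝟙 i j ≈ 0#
  𝟙-off {i = i} {j} i≢j with i ≟ j
  ... | yes i≡j = contradiction i≡j i≢j
  ... | no _    = refl

  -- A diagonal entry is its row sum minus the other entries of the row. For Laplacians, whose rows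
  -- sum to zero, this leaves only the off-diagonal entries to compare.
  agree : ∀ {n} {A B : Matrix n} → (∀ i j → i ≢ j → A i j ≈ B i j) →
          (∀ i → sum (A i) ≈ sum (B i)) → A ≋ B
  agree {n} {A} {B} off row i j with i ≟ j
  ... | no i≢j = off i j i≢j
  ... | yes ≡.refl = begin
    A i i                       ≈⟨ diagonal A ⟩
    sum (A i) - sum (others A)  ≈⟨ +-cong (row i) (-‿cong (sum-cong-≋ others-agree)) ⟩
    sum (B i) - sum (others B)  ≈⟨ diagonal B ⟨
    B i i                       ∎
    where
    -- The entry at `i` is replaced by zero, so that the sum of the remaining entries still runs
    -- over all of `Fin n`.
    others : Matrix n → Vector Carrier n
    others C j = if does (i ≟ j) then 0# else C i j
    others-agree : ∀ j → others A j ≈ others B j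
    others-agree j with i ≟ j
    ... | yes _   = refl
    ... | no i≢j = off i j i≢j
    split : ∀ C j → C i j ≈ (if does (i ≟ j) then C i j else 0#) + others C j
    split C j with does (i ≟ j)
    ... | true  = sym (+-identityʳ _)
    ... | false = sym (+-identityˡ _)
    diagonal : ∀ C → C i i ≈ sum (C i) - sum (others C)
    diagonal C = begin
      C i i                                             ≈⟨ x+y-y≈x (C i i) (sum (others C)) ⟨
      C i i + sum (others C) - sum (others C)           ≈⟨ +-congʳ (+-congʳ (∑-single i (C i))) ⟨
      sum (λ j → if does (i ≟ j) then C i j else 0#) + sum (others C) - sum (others C)
                                                        ≈⟨ +-congʳ (∑-distrib-+ (λ j → if does (i ≟ j) then C i j else 0#) (others C)) ⟨
      sum (λ j → (if does (i ≟ j) then C i j else 0#) + others C j) - sum (others C)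
                                                        ≈⟨ +-congʳ (sum-cong-≋ (split C)) ⟨
      sum (C i) - sum (others C)                        ∎

-- The Laplacian as a sum of rank-one edge matrices.

module LaplacianAsEdgeSum {c ℓ₁ ℓ₂ ℓ₃} (F : OrderedHeytingField c ℓ₁ ℓ₂ ℓ₃) where

  open OrderedHeytingField F hiding (zero)
  open OrderedHeytingFieldProperties F
  open Matrices F
  open WeightedMultigraphs F
  open FormsAndUpdates F
  open CommutativeRing commutativeRing using (ring; semiring)
  open RingProperties ring
  open SemiringSum semiring
  open IntegerCoefficients commutativeRing
  open SetoidReasoning setoid

  edgeMatrix : ∀ {n} → Edge n → Matrix n
  edgeMatrix e = outer (weight e) (δ (end₁ e) (end₂ e))

  edgeSum : ∀ {n} → Multigraph n → Matrix n
  edgeSum []      i j = 0#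
  edgeSum (e ∷ G) i j = edgeMatrix e i j + edgeSum G i j

  -- Exchanging the ends negates b, which leaves b bᵀ unchanged; the matrix therefore does not see
  -- the orientation in which an edge is stored.
  edgeMatrix-joins : ∀ {n} {k t : Fin n} {w} (e : Edge n) → Joins k t e → weight e ≈ w →
                     edgeMatrix e ≋ outer w (δ k t)
  edgeMatrix-joins e (inj₁ (≡.refl , ≡.refl)) we≈w i j = *-congʳ we≈w
  edgeMatrix-joins {k = k} {t} e (inj₂ (≡.refl , ≡.refl)) we≈w i j = *-cong we≈w
    (solve 4 (λ a b c d → (a :- b) :* (c :- d) := (b :- a) :* (d :- c)) refl (𝟙 t i) (𝟙 k i) (𝟙 t j) (𝟙 k j))

  edgeMatrix-cong : ∀ {n} (e f : Edge n) → e ≈ₑ f → edgeMatrix e ≋ edgeMatrix f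
  edgeMatrix-cong e f (e~f , we≈wf) = edgeMatrix-joins e e~f we≈wf

  edgeSum-cong : ∀ {n} {G H : Multigraph n} → G ≅ H → edgeSum G ≋ edgeSum H
  edgeSum-cong (Perm.refl G≈H) = pointwise G≈H
    where
    pointwise : ∀ {G H} → Pointwise _≈ₑ_ G H → edgeSum G ≋ edgeSum H
    pointwise [] i j = refl
    pointwise (_∷_ {x = e} {y = f} e≈f G≈H) i j = +-cong (edgeMatrix-cong e f e≈f i j) (pointwise G≈H i j)
  edgeSum-cong (Perm.prep {x = e} {y = f} e≈f G≅H) i j = +-cong (edgeMatrix-cong e f e≈f i j) (edgeSum-cong G≅H i j)
  edgeSum-cong (Perm.swap {x = e} {y = f} {x′ = e′} {y′ = f′} e≈e′ f≈f′ G≅H) i j = trans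
    (+-cong (edgeMatrix-cong e e′ e≈e′ i j) (+-cong (edgeMatrix-cong f f′ f≈f′ i j) (edgeSum-cong G≅H i j)))
    (solve 3 (λ x y z → x :+ (y :+ z) := y :+ (x :+ z)) refl _ _ _)
  edgeSum-cong (Perm.trans G≅H H≅K) i j = trans (edgeSum-cong G≅H i j) (edgeSum-cong H≅K i j)

  -- The row sums are the product with the all-ones vector, which is orthogonal to b.
  ∑-edgeMatrix : ∀ {n} (e : Edge n) i → sum (edgeMatrix e i) ≈ 0#
  ∑-edgeMatrix {n} e i = begin
    sum (edgeMatrix e i)                          ≈⟨ sum-cong-≋ (λ j → *-identityʳ (edgeMatrix e i j)) ⟨
    ∑[ j < n ] (edgeMatrix e i j * 1#)            ≈⟨ ∑-outer (weight e) u (λ _ → 1#) i ⟩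
    weight e * u i * ∑[ j < n ] (u j * 1#)        ≈⟨ *-congˡ (trans (∑-δ (end₁ e) (end₂ e) (λ _ → 1#)) (-‿inverseʳ 1#)) ⟩
    weight e * u i * 0#                           ≈⟨ zeroʳ _ ⟩
    0#                                            ∎
    where
    u : Vector Carrier n
    u = δ (end₁ e) (end₂ e)

  ∑-edgeSum : ∀ {n} (G : Multigraph n) i → sum (edgeSum G i) ≈ 0#
  ∑-edgeSum {n} []      i = sum-replicate-zero n
  ∑-edgeSum     (e ∷ G) i = begin
    sum (edgeSum (e ∷ G) i)                  ≈⟨ ∑-distrib-+ (edgeMatrix e i) (edgeSum G i) ⟩
    sum (edgeMatrix e i) + sum (edgeSum G i) ≈⟨ +-cong (∑-edgeMatrix e i) (∑-edgeSum G i) ⟩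
    0# + 0#                                  ≈⟨ +-identityˡ 0# ⟩
    0#                                       ∎

  weightBetween : ∀ {n} → Edge n → Fin n → Fin n → Carrier
  weightBetween e i j = if does (joins? i j e) then weight e else 0#

  totalWeight-∷ : ∀ {n} (e : Edge n) G i j →
                  totalWeight (e ∷ G) i j ≈ weightBetween e i j + totalWeight G i j
  totalWeight-∷ e G i j with does (joins? i j e)
  ... | true  = refl
  ... | false = sym (+-identityˡ _)

  -- Off the diagonal, b_i b_j is -1 when the ends are `i` and `j` in some order, and 0 otherwise.
  -- The four comparisons are those on which both `joins?` and the entries of `𝟙` depend.
  edgeMatrix-off : ∀ {n} (e : Edge n) {i j} → i ≢ j → - weightBetween e i j ≈ edgeMatrix e i j
  edgeMatrix-off e {i} {j} i≢j with end₁ e ≟ i | end₂ e ≟ j | end₁ e ≟ j | end₂ e ≟ i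
  -- The first four clauses would force `i ≡ j` or a loop.
  ... | yes p | _     | yes q | _     = contradiction (≡.trans (≡.sym p) q) i≢j
  ... | yes p | _     | _     | yes q = contradiction (≡.trans p (≡.sym q)) (loopless e)
  ... | _     | yes p | yes q | _     = contradiction (≡.trans q (≡.sym p)) (loopless e)
  ... | _     | yes p | _     | yes q = contradiction (≡.trans (≡.sym q) p) i≢j
  ... | yes _ | yes _ | no _  | no _  =
    solve 1 (λ w → :- w := w :* ((con (+ 1) :- con (+ 0)) :* (con (+ 0) :- con (+ 1)))) refl (weight e)
  ... | no _  | no _  | yes _ | yes _ =
    solve 1 (λ w → :- w := w :* ((con (+ 0) :- con (+ 1)) :* (con (+ 1) :- con (+ 0)))) refl (weight e)
  -- From here at most one comparison succeeds, so b_i or b_j vanishes.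
  ... | yes _ | no _  | no _  | no _  =
    solve 1 (λ w → :- con (+ 0) := w :* ((con (+ 1) :- con (+ 0)) :* (con (+ 0) :- con (+ 0)))) refl (weight e)
  ... | no _  | yes _ | no _  | no _  =
    solve 1 (λ w → :- con (+ 0) := w :* ((con (+ 0) :- con (+ 0)) :* (con (+ 0) :- con (+ 1)))) refl (weight e)
  ... | no _  | no _  | yes _ | no _  =
    solve 1 (λ w → :- con (+ 0) := w :* ((con (+ 0) :- con (+ 0)) :* (con (+ 1) :- con (+ 0)))) refl (weight e)
  ... | no _  | no _  | no _  | yes _ =
    solve 1 (λ w → :- con (+ 0) := w :* ((con (+ 0) :- con (+ 1)) :* (con (+ 0) :- con (+ 0)))) refl (weight e)
  ... | no _  | no _  | no _  | no _  =
    solve 1 (λ w → :- con (+ 0) := w :* ((con (+ 0) :- con (+ 0)) :* (con (+ 0) :- con (+ 0)))) refl (weight e)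

  -totalWeight≈edgeSum : ∀ {n} (G : Multigraph n) {i j} → i ≢ j → - totalWeight G i j ≈ edgeSum G i j
  -totalWeight≈edgeSum []      i≢j = -0#≈0#
  -totalWeight≈edgeSum (e ∷ G) {i} {j} i≢j = begin
    - totalWeight (e ∷ G) i j                        ≈⟨ -‿cong (totalWeight-∷ e G i j) ⟩
    - (weightBetween e i j + totalWeight G i j)      ≈⟨ -‿+-comm _ _ ⟨
    - weightBetween e i j - totalWeight G i j        ≈⟨ +-cong (edgeMatrix-off e i≢j) (-totalWeight≈edgeSum G i≢j) ⟩
    edgeMatrix e i j + edgeSum G i j                 ∎

  laplacian≋edgeSum : ∀ {n} (G : Multigraph n) → laplacian G ≋ edgeSum G
  laplacian≋edgeSum G = agree off (λ i → trans (laplacian-row G i) (sym (∑-edgeSum G i)))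
    where
    off : ∀ i j → i ≢ j → laplacian G i j ≈ edgeSum G i j
    off i j i≢j with i ≟ j
    ... | yes i≡j = contradiction i≡j i≢j
    ... | no _    = -totalWeight≈edgeSum G i≢j

  -- In terms of edge sums the three kinds of change become one: each adds ε b bᵀ with b = e_k -
  -- e_t.
  laplacian-update : ∀ {n k t ε} {G G′ : Multigraph n} → DiffersInEdge k t ε G G′ →
                     laplacian G′ ≋ laplacian G ⊕ outer ε (δ k t)
  laplacian-update {k = k} {t} {ε} {G} {G′} G~G′ i j = begin
    laplacian G′ i j                    ≈⟨ laplacian≋edgeSum G′ i j ⟩
    edgeSum G′ i j                      ≈⟨ edgeSum-update G~G′ ⟩
    edgeSum G i j + ε * u               ≈⟨ +-congʳ (laplacian≋edgeSum G i j) ⟨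
    laplacian G i j + ε * u             ∎
    where
    u : Carrier
    u = δ k t i * δ k t j
    edgeSum-update : DiffersInEdge k t ε G G′ → edgeSum G′ i j ≈ edgeSum G i j + ε * u
    edgeSum-update (reweighted e e′ H G≅ G′≅ e-kt e′-kt we′≈) = begin
      edgeSum G′ i j                                ≈⟨ edgeSum-cong G′≅ i j ⟩
      edgeMatrix e′ i j + edgeSum H i j             ≈⟨ +-congʳ (edgeMatrix-joins e′ e′-kt we′≈ i j) ⟩
      (weight e + ε) * u + edgeSum H i j            ≈⟨ solve 4 (λ w ε u h → (w :+ ε) :* u :+ h := w :* u :+ h :+ ε :* u)
                                                         refl (weight e) ε u (edgeSum H i j) ⟩
      weight e * u + edgeSum H i j + ε * u          ≈⟨ +-congʳ (+-congʳ (edgeMatrix-joins e e-kt refl i j)) ⟨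
      edgeMatrix e i j + edgeSum H i j + ε * u      ≈⟨ +-congʳ (edgeSum-cong G≅ i j) ⟨
      edgeSum G i j + ε * u                         ∎
    edgeSum-update (added e _ G′≅ e-kt we≈ε) = begin
      edgeSum G′ i j                                ≈⟨ edgeSum-cong G′≅ i j ⟩
      edgeMatrix e i j + edgeSum G i j              ≈⟨ +-comm _ _ ⟩
      edgeSum G i j + edgeMatrix e i j              ≈⟨ +-congˡ (edgeMatrix-joins e e-kt we≈ε i j) ⟩
      edgeSum G i j + ε * u                         ∎
    edgeSum-update (removed e _ G≅ e-kt we≈-ε) = begin
      -- The removed edge has weight `- ε`, so its matrix is introduced here together with its
      -- negative and then merged into `edgeSum G`.
      edgeSum G′ i j                                ≈⟨ solve 3 (λ ε u g → g := :- ε :* u :+ g :+ ε :* u)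
                                                         refl ε u (edgeSum G′ i j) ⟩
      - ε * u + edgeSum G′ i j + ε * u              ≈⟨ +-congʳ (+-congʳ (edgeMatrix-joins e e-kt we≈-ε i j)) ⟨
      edgeMatrix e i j + edgeSum G′ i j + ε * u     ≈⟨ +-congʳ (edgeSum-cong G≅ i j) ⟨
      edgeSum G i j + ε * u                         ∎

  -- Each edge contributes its positive weight times the square of bᵀx.
  form-laplacian-nonNeg : ∀ {n} (G : Multigraph n) x → NonNegative (form (laplacian G) x)
  form-laplacian-nonNeg {n} G x = nonNeg-resp-≈ (sym (form-cong (laplacian≋edgeSum G) x)) (form-edgeSum-nonNeg G)
    where
    form-edgeSum-nonNeg : ∀ G → NonNegative (form (edgeSum G) x)
    form-edgeSum-nonNeg [] = ∑-nonNeg _ (λ i → nonNeg-resp-≈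
      (sym (trans (*-congˡ (trans (sum-cong-≋ (λ j → zeroˡ (x j))) (sum-replicate-zero n))) (zeroʳ (x i)))) 0-nonNeg)
    form-edgeSum-nonNeg (e ∷ G) = nonNeg-resp-≈
      (sym (trans (form-⊕ (edgeMatrix e) (edgeSum G) x) (+-congʳ (form-outer (weight e) _ x))))
      (+-nonNeg (*-nonNeg (pos⇒nonNeg (weight-pos e)) (sq-nonNeg _)) (form-edgeSum-nonNeg G))

-- Forest distances: positivity and the effect of one edge.

module ForestDistances {c ℓ₁ ℓ₂ ℓ₃} (F : OrderedHeytingField c ℓ₁ ℓ₂ ℓ₃) where

  open OrderedHeytingField F hiding (zero)
  open OrderedHeytingFieldProperties F
  open Matrices F
  open WeightedMultigraphs F
  open FormsAndUpdates F
  open LaplacianAsEdgeSum F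
  open CommutativeRing commutativeRing using (ring; semiring)
  open RingProperties ring
  open HeytingProperties heytingCommutativeRing using (#-congʳ)
  open SemiringSum semiring
  open IntegerCoefficients commutativeRing
  open SetoidReasoning setoid

  cross⇒/ : ∀ {a b x y} (y#0 : y # 0#) → a * y ≈ b * x → a ≈ b * (x / y [ y#0 ])
  cross⇒/ {a} {b} {x} {y} y#0 ay≈bx = begin
    a                            ≈⟨ *-identityʳ a ⟨
    a * 1#                       ≈⟨ *-congˡ (/-inverseʳ y#0) ⟨
    a * (y * (1# / y [ y#0 ]))   ≈⟨ *-assoc _ _ _ ⟨
    -- The quotient of `1#` carries a factor `1#`; dropping it leaves the bare inverse that occurs
    -- in `x / y [ y#0 ]`.
    a * y * (1# / y [ y#0 ])     ≈⟨ *-cong ay≈bx (*-identityˡ _) ⟩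
    b * x * _                    ≈⟨ *-assoc _ _ _ ⟩
    b * (x / y [ y#0 ])          ∎

  module ForestMetricProperties (α : Carrier) (α>0 : 0# < α) {n : ℕ} (G : Multigraph n) where

    open ForestMetric α α>0 G

    q⊗𝟙+αL : q ⊗ 𝟙+αL ≋ 𝟙
    q⊗𝟙+αL = proj₁ (proj₂ 𝟙+αL-invertible)

    𝟙+αL⊗q : 𝟙+αL ⊗ q ≋ 𝟙
    𝟙+αL⊗q = proj₂ (proj₂ 𝟙+αL-invertible)

    q-sym : Symmetric q
    q-sym = inverse-sym (λ i j → +-cong (𝟙-sym i j) (*-congˡ (laplacian-sym G i j))) q⊗𝟙+αL 𝟙+αL⊗q

    ½ : Carrier
    ½ = 1# / 2# [ 2#0 ]

    ½-pos : 0# < ½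
    ½-pos = inverse-pos (+-pos 0<1 0<1) 2#0

    2d : ∀ i j → 2# * d i j ≈ q i i + q j j - q i j - q j i
    2d i j = trans (sym (*-assoc 2# ½ _)) (trans (*-congʳ (/-inverseʳ 2#0)) (*-identityˡ _))

    -- The bracket is bᵀQb for b = `δ k t`, which ties the distance both to the quadratic form and
    -- to the update of `π`.
    d≈½[πk-πt] : ∀ k t → d k t ≈ ½ * (π k k t - π t k t)
    d≈½[πk-πt] k t = *-congˡ (solve 4 (λ a b x y → a :+ b :- x :- y := (a :- x) :- (y :- b)) refl
                               (q k k) (q t t) (q k t) (q t k))

    d≈½[q+q]-q : ∀ i j → d i j ≈ ½ * (q i i + q j j) - q i j
    d≈½[q+q]-q i j = begin
      ½ * (q i i + q j j - q i j - q j i)       ≈⟨ *-congˡ (+-congˡ (-‿cong (q-sym j i))) ⟩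
      ½ * (q i i + q j j - q i j - q i j)       ≈⟨ solve 3 (λ h s x → h :* (s :- x :- x) := h :* s :- con (+ 2) :* h :* x)
                                                     refl ½ (q i i + q j j) (q i j) ⟩
      ½ * (q i i + q j j) - 2# * ½ * q i j      ≈⟨ +-congˡ (-‿cong (trans (*-congʳ (/-inverseʳ 2#0)) (*-identityˡ _))) ⟩
      ½ * (q i i + q j j) - q i j               ∎

    -- The terms in `q i i` cancel, so `τ` and `- π` differ by an amount independent of `i`.
    τ≈½[q-q]-π : ∀ i k t → τ i k t ≈ ½ * (q k k - q t t) - π i k t
    τ≈½[q-q]-π i k t = trans (+-cong (d≈½[q+q]-q i k) (-‿cong (d≈½[q+q]-q i t)))
      (solve 6 (λ h a b c x y → h :* (a :+ b) :- x :- (h :* (a :+ c) :- y) := h :* (b :- c) :- (x :- y)) refl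
        ½ (q i i) (q k k) (q t t) (q i k) (q i t))

    -- The common amount cancels in the difference, leaving `π` differences up to sign; squaring
    -- removes the sign.
    [τ-τ]²≈[π-π]² : ∀ i j k t → (τ i k t - τ j k t) * (τ i k t - τ j k t) ≈ (π i k t - π j k t) * (π i k t - π j k t)
    [τ-τ]²≈[π-π]² i j k t = trans (*-cong τ-τ τ-τ)
      (solve 3 (λ s x y → (s :- x :- (s :- y)) :* (s :- x :- (s :- y)) := (x :- y) :* (x :- y)) refl
        (½ * (q k k - q t t)) (π i k t) (π j k t))
      where
      τ-τ = +-cong (τ≈½[q-q]-π i k t) (-‿cong (τ≈½[q-q]-π j k t))

    ∑-q*δ : ∀ i k t → ∑[ m < n ] (q i m * δ k t m) ≈ π i k t
    ∑-q*δ i k t = trans (sum-cong-≋ (λ m → *-comm (q i m) (δ k t m))) (∑-δ k t (q i))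

    ∑-δ*q : ∀ j k t → ∑[ m < n ] (δ k t m * q m j) ≈ π j k t
    ∑-δ*q j k t = trans (∑-δ k t (λ m → q m j)) (+-cong (q-sym k j) (-‿cong (q-sym t j)))

    𝟙+αL⊗π : ∀ k t i → ∑[ m < n ] (𝟙+αL i m * π m k t) ≈ δ k t i
    𝟙+αL⊗π k t i = begin
      ∑[ m < n ] (𝟙+αL i m * (q m k - q m t))
        ≈⟨ sum-cong-≋ (λ m → x[y-z]≈xy-xz (𝟙+αL i m) (q m k) (q m t)) ⟩
      ∑[ m < n ] (𝟙+αL i m * q m k - 𝟙+αL i m * q m t)
        ≈⟨ ∑-distrib-+ (λ m → 𝟙+αL i m * q m k) (λ m → - (𝟙+αL i m * q m t)) ⟩
      (𝟙+αL ⊗ q) i k + ∑[ m < n ] (- (𝟙+αL i m * q m t))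
        ≈⟨ +-congˡ (-‿∑ (λ m → 𝟙+αL i m * q m t)) ⟩
      (𝟙+αL ⊗ q) i k - (𝟙+αL ⊗ q) i t
        ≈⟨ +-cong (𝟙+αL⊗q i k) (-‿cong (𝟙+αL⊗q i t)) ⟩
      𝟙 i k - 𝟙 i t
        ≈⟨ +-cong (𝟙-sym i k) (-‿cong (𝟙-sym i t)) ⟩
      δ k t i ∎

    -- With x = Qb one has Wx = b, so xᵀWx collapses to xᵀb.
    form-π : ∀ k t → form 𝟙+αL (λ i → π i k t) ≈ π k k t - π t k t
    form-π k t = trans
      (sum-cong-≋ (λ i → trans (*-congˡ (𝟙+αL⊗π k t i)) (*-comm (π i k t) (δ k t i))))
      (∑-δ k t (λ i → π i k t))

    -- Supplies the nonzero denominators. The form of W = I + αL at x = Qb is the sum of the squares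
    -- of the entries of x plus α times a nonnegative Laplacian form.
    d-pos : ∀ {k t} → k ≢ t → 0# < d k t
    d-pos {k} {t} k≢t = <-respʳ-≈ (sym (trans (d≈½[πk-πt] k t) (*-congˡ (sym (form-π k t))))) (*-pos ½-pos form-pos)
      where
      x : Vector Carrier n
      x i = π i k t

      0<δk : 0# < δ k t k
      0<δk = <-respʳ-≈ (sym (trans (+-cong (𝟙-diag k) (-‿cong (𝟙-off (λ t≡k → k≢t (≡.sym t≡k)))))
                                   (trans (+-congˡ -0#≈0#) (+-identityʳ 1#)))) 0<1

      ∑x²-pos : 0# < ∑[ i < n ] (x i * x i)
      ∑x²-pos =
        -- Row `k` of Wx = b sums to 1, so some summand W_km x_m is positive, and its factor x_m is
        -- apart from zero.
        let m , 0<Wx = 0<∑⇒∃ _ (<-respʳ-≈ (sym (𝟙+αL⊗π k t k)) 0<δk)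
            xm#0 = x*y#0⇒x#0 (#-congʳ (*-comm _ _) (#-sym (<⇒# 0<Wx)))
        in  ∑-pos (λ i → x i * x i) (λ i → sq-nonNeg (x i)) m (sq-pos xm#0)

      form-pos : 0# < form 𝟙+αL x
      form-pos = <-respʳ-≈
        (sym (trans (form-⊕ 𝟙 (α ⊙ laplacian G) x) (+-cong (form-𝟙 x) (form-⊙ α (laplacian G) x))))
        (pos+nonNeg ∑x²-pos (*-nonNeg (pos⇒nonNeg α>0) (form-laplacian-nonNeg G x)))

  -- Changes of `q` and `d` under a single edge change.

  module EdgeChange (α : Carrier) (α>0 : 0# < α) {n : ℕ} (G G′ : Multigraph n)
    {k t : Fin n} {ε : Carrier} (G~G′ : DiffersInEdge k t ε G G′) where

    open ForestMetric α α>0 G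
    open ForestMetric α α>0 G′ using () renaming (𝟙+αL to 𝟙+αL′; q to q′; d to d′; π to π′)
    open ForestMetricProperties α α>0 G
    open ForestMetricProperties α α>0 G′ using ()
      renaming (q⊗𝟙+αL to q′⊗𝟙+αL′; ∑-q*δ to ∑-q′*δ; d≈½[πk-πt] to d′≈½[π′k-π′t]; 2d to 2d′)

    p p′ : Fin n → Carrier
    p  i = π  i k t
    p′ i = π′ i k t

    𝟙+αL-update : 𝟙+αL′ ≋ 𝟙+αL ⊕ outer (α * ε) (δ k t)
    𝟙+αL-update i j = trans (+-congˡ (*-congˡ (laplacian-update G~G′ i j)))
      (solve 5 (λ o α l ε u → o :+ α :* (l :+ ε :* u) := o :+ α :* l :+ α :* ε :* u) refl
        (𝟙 i j) α (laplacian G i j) ε (δ k t i * δ k t j))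

    -- One factor is primed and the other is not. This mixed form is the common source of the primed
    -- and the unprimed equalities.
    q-update : ∀ i j → q i j ≈ q′ i j + α * ε * (p′ i * p j)
    q-update i j = trans (resolvent 𝟙+αL-update q′⊗𝟙+αL′ 𝟙+αL⊗q i j)
      (+-congˡ (*-congˡ (*-cong (∑-q′*δ i k t) (∑-δ*q j k t))))

    π-update : ∀ i → p i ≈ p′ i + α * ε * (p′ i * (p k - p t))
    π-update i = trans (+-cong (q-update i k) (-‿cong (q-update i t)))
      (solve 6 (λ x y c z a b → (x :+ c :* (z :* a)) :- (y :+ c :* (z :* b)) := (x :- y) :+ c :* (z :* (a :- b))) refl
        (q′ i k) (q′ i t) (α * ε) (p′ i) (p k) (p t))

    -- Write c = αε and D = `p k - p t`, which is twice `d k t`. Then p_i = p′_i (1 + cD), and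
    -- subtracting the cases `k` and `t` gives D = D′ (1 + cD): both quantities scale by the same
    -- factor.
    π′d≈πd′ : ∀ i → p′ i * d k t ≈ p i * d′ k t
    π′d≈πd′ i = begin
      p′ i * d k t                        ≈⟨ *-congˡ (trans (d≈½[πk-πt] k t) (*-congˡ D-update)) ⟩
      p′ i * (½ * (D′ + α * ε * (D′ * D)))
        ≈⟨ solve 5 (λ x h D′ c D → x :* (h :* (D′ :+ c :* (D′ :* D))) := (x :+ c :* (x :* D)) :* (h :* D′)) refl
             (p′ i) ½ D′ (α * ε) D ⟩
      (p′ i + α * ε * (p′ i * D)) * (½ * D′)
        ≈⟨ *-cong (π-update i) (d′≈½[π′k-π′t] k t) ⟨
      p i * d′ k t                        ∎
      where
      D  = p k - p t
      D′ = p′ k - p′ t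
      D-update : D ≈ D′ + α * ε * (D′ * D)
      D-update = trans (+-cong (π-update k) (-‿cong (π-update t)))
        (solve 4 (λ x y c D → (x :+ c :* (x :* D)) :- (y :+ c :* (y :* D)) := (x :- y) :+ c :* ((x :- y) :* D)) refl
          (p′ k) (p′ t) (α * ε) D)

    Δq≈ : ∀ i j → q′ i j - q i j ≈ - (α * ε) * (p′ i * p j)
    Δq≈ i j = trans (+-congˡ (-‿cong (q-update i j)))
      (solve 3 (λ x c y → x :- (x :+ c :* y) := :- c :* y) refl (q′ i j) (α * ε) (p′ i * p j))

    -- The four changes of `q` are products p′p with one coefficient, and their signed sum factors.
    2Δd≈ : ∀ i j → 2# * (d′ i j - d i j) ≈ - (α * ε) * ((p′ i - p′ j) * (p i - p j))
    2Δd≈ i j = begin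
      2# * (d′ i j - d i j)
        ≈⟨ x[y-z]≈xy-xz 2# (d′ i j) (d i j) ⟩
      2# * d′ i j - 2# * d i j
        ≈⟨ +-cong (2d′ i j) (-‿cong (2d i j)) ⟩
      q′ i i + q′ j j - q′ i j - q′ j i - (q i i + q j j - q i j - q j i)
        ≈⟨ solve 8 (λ a′ b′ x′ y′ a b x y →
             a′ :+ b′ :- x′ :- y′ :- (a :+ b :- x :- y) := (a′ :- a) :+ (b′ :- b) :- (x′ :- x) :- (y′ :- y)) refl
             (q′ i i) (q′ j j) (q′ i j) (q′ j i) (q i i) (q j j) (q i j) (q j i) ⟩
      (q′ i i - q i i) + (q′ j j - q j j) - (q′ i j - q i j) - (q′ j i - q j i)
        ≈⟨ +-cong (+-cong (+-cong (Δq≈ i i) (Δq≈ j j)) (-‿cong (Δq≈ i j))) (-‿cong (Δq≈ j i)) ⟩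
      g * (p′ i * p i) + g * (p′ j * p j) - g * (p′ i * p j) - g * (p′ j * p i)
        ≈⟨ solve 5 (λ g x′ y′ x y →
             g :* (x′ :* x) :+ g :* (y′ :* y) :- g :* (x′ :* y) :- g :* (y′ :* x) := g :* ((x′ :- y′) :* (x :- y))) refl
             g (p′ i) (p′ j) (p i) (p j) ⟩
      g * ((p′ i - p′ j) * (p i - p j)) ∎
      where g = - (α * ε)

    module _ (d#0 : d k t # 0#) where

      r = d′ k t / d k t [ d#0 ]

      -- Trades the primed factor of a mixed formula for an unprimed one, at the cost of one ratio
      -- of distances.
      p′≈pr : ∀ i → p′ i ≈ p i * r
      p′≈pr i = cross⇒/ d#0 (π′d≈πd′ i)

      Δq≈ππ : ∀ i j → q′ i j - q i j ≈ - (α * ε) * (p i * p j) * r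
      Δq≈ππ i j = trans (trans (Δq≈ i j) (*-congˡ (*-congʳ (p′≈pr i))))
        (solve 4 (λ g x r y → g :* (x :* r :* y) := g :* (x :* y) :* r) refl (- (α * ε)) (p i) r (p j))

      2Δd≈ππ : ∀ i j → 2# * (d′ i j - d i j) ≈ - (α * ε) * ((p i - p j) * (p i - p j)) * r
      2Δd≈ππ i j = trans (trans (2Δd≈ i j) (*-congˡ (*-congʳ (+-cong (p′≈pr i) (-‿cong (p′≈pr j))))))
        (solve 4 (λ g x r y → g :* ((x :* r :- y :* r) :* (x :- y)) := g :* ((x :- y) :* (x :- y)) :* r) refl
          (- (α * ε)) (p i) r (p j))

    module _ (d′#0 : d′ k t # 0#) where

      r′ = d k t / d′ k t [ d′#0 ]

      -- The reverse trade, with the reciprocal ratio.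
      p≈p′r′ : ∀ i → p i ≈ p′ i * r′
      p≈p′r′ i = cross⇒/ d′#0 (sym (π′d≈πd′ i))

      Δq≈π′π′ : ∀ i j → q′ i j - q i j ≈ - (α * ε) * (p′ i * p′ j) * r′
      Δq≈π′π′ i j = trans (trans (Δq≈ i j) (*-congˡ (*-congˡ (p≈p′r′ j))))
        (solve 4 (λ g x r y → g :* (x :* (y :* r)) := g :* (x :* y) :* r) refl (- (α * ε)) (p′ i) r′ (p′ j))

      2Δd≈π′π′ : ∀ i j → 2# * (d′ i j - d i j) ≈ - (α * ε) * ((p′ i - p′ j) * (p′ i - p′ j)) * r′
      2Δd≈π′π′ i j = trans (trans (2Δd≈ i j) (*-congˡ (*-congˡ (+-cong (p≈p′r′ i) (-‿cong (p≈p′r′ j))))))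
        (solve 4 (λ g x r y → g :* ((x :- y) :* (x :* r :- y :* r)) := g :* ((x :- y) :* (x :- y)) :* r) refl
          (- (α * ε)) (p′ i) r′ (p′ j))

proposition8 :
  ∀ {c ℓ₁ ℓ₂ ℓ₃} (F : OrderedHeytingField c ℓ₁ ℓ₂ ℓ₃) →
  let open OrderedHeytingField F
      open OrderedHeytingFieldProperties F
      open WeightedMultigraphs F in
  (α : Carrier) (α>0 : 0# < α) {n : ℕ} (G G′ : Multigraph n)
  (k t : Fin n) → k ≢ t → (ε : Carrier) → ε # 0# →
  DiffersInEdge k t ε G G′ →
  let open ForestMetric α α>0 G
      open ForestMetric α α>0 G′ using () renaming (q to q′)
      open ForestMetric α α>0 G′ using () renaming (d to d′)
      open ForestMetric α α>0 G′ using () renaming (τ to τ′)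
      open ForestMetric α α>0 G′ using () renaming (π to π′)
      Δq = λ i j → q′ i j - q i j
      Δd = λ i j → d′ i j - d i j in
  Σ[ d#0 ∈ d k t # 0# ] Σ[ d′#0 ∈ d′ k t # 0# ]
  (∀ (i j : Fin n) →
    (Δq i j ≈ - (α * ε) * (π i k t * π j k t) * (d′ k t / d k t [ d#0 ])) ×
    (Δq i j ≈ - (α * ε) * (π′ i k t * π′ j k t) * (d k t / d′ k t [ d′#0 ])) ×
    (2# * Δd i j ≈ - (α * ε) * ((τ i k t - τ j k t) * (τ i k t - τ j k t)) * (d′ k t / d k t [ d#0 ])) ×
    (2# * Δd i j ≈ - (α * ε) * ((τ′ i k t - τ′ j k t) * (τ′ i k t - τ′ j k t)) * (d k t / d′ k t [ d′#0 ])) ×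
    (2# * Δd i j ≈ - (α * ε) * ((π i k t - π j k t) * (π i k t - π j k t)) * (d′ k t / d k t [ d#0 ])) ×
    (2# * Δd i j ≈ - (α * ε) * ((π′ i k t - π′ j k t) * (π′ i k t - π′ j k t)) * (d k t / d′ k t [ d′#0 ])))
proposition8 F α α>0 G G′ k t k≢t ε _ G~G′ =
  d#0 , d′#0 , λ i j →
    Δq≈ππ d#0 i j ,
    Δq≈π′π′ d′#0 i j ,
    -- The `τ` equalities are the `π` equalities with the squared difference rewritten.
    trans (2Δd≈ππ d#0 i j) (*-congʳ (*-congˡ (sym ([τ-τ]²≈[π-π]² G i j k t)))) ,
    trans (2Δd≈π′π′ d′#0 i j) (*-congʳ (*-congˡ (sym ([τ-τ]²≈[π-π]² G′ i j k t)))) ,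
    2Δd≈ππ d#0 i j ,
    2Δd≈π′π′ d′#0 i j
  where
  open OrderedHeytingField F
  open ForestDistances F
  open ForestMetricProperties α α>0
  open EdgeChange α α>0 G G′ G~G′
  d#0 = #-sym (<⇒# (d-pos G k≢t))
  d′#0 = #-sym (<⇒# (d-pos G′ k≢t))
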